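{- Consider a vertex-fault-tolerant labeling scheme $(L_0,L_1)$ for $n$-vertex graphs, where $L_i$ assigns $b_i$-bit labels to the vertices ($i\in\{0,1\}$). Suppose that given $L_0(s)$, $L_0(t)$ and $\{L_1(v)\mid v\in F\}$, where $|F|\le f$, the scheme reports whether $s,t$ are connected in $G-F$. Then either $b_0=\Omega(f)$ or $b_1=\Omega(n)$.
   Context: A labeling scheme $(L_0,L_1)$ assigns, for every $n$-vertex undirected graph $G=(V,E)$, to each vertex $v\in V$ a $b_0$-bit label $L_0(v)$ and a $b_1$-bit label $L_1(v)$, and has a query algorithm that, seeing only the listed labels (and not $G$), answers every query $\langle s,t,F\rangle$ with $s,t\in V\setminus F$, $F\subseteq V$, $|F|\le f$. $G-F$ is the subgraph induced by $V\setminus F$. The conclusion is to be read as: there is an absolute constant $c>0$ such that $b_0\ge cf$ or $b_1\ge cn$.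
   Formalization: The formal version assumes n ≥ 2 and f ≤ n; without these the claim fails literally (for n = f = 1 empty labels suffice, and for f much larger than n² one can store the whole graph in L_0). -}

module Defs where

open import Data.Bool using (Bool; true; false)
open import Data.Fin using (Fin)
open import Data.Fin.Subset using (Subset; _∉_; ∣_∣)
open import Data.Fin.Subset.Properties using (_∈?_)
open import Data.Integer using (+_)
open import Data.List using (List; map; filter; allFin)
open import Data.List.Relation.Binary.Permutation.Propositional using (_↭_)
open import Data.Nat using (ℕ; _≤_)
open import Data.Product using (_×_)
open import Data.Rational using (ℚ; _/_)
open import Data.Vec using (Vec)
open import Function using (_⇔_)
open import Relation.Binary.Construct.Closure.ReflexiveTransitive using (Star)
open import Relation.Binary.PropositionalEquality using (_≡_)

record Graph (n : ℕ) : Set where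
  field
    adj    : Fin n → Fin n → Bool
    sym    : ∀ u v → adj u v ≡ adj v u
    irrefl : ∀ v → adj v v ≡ false

-- The edge relation of G - F, the subgraph of G induced by V ∖ F.
EdgeAvoiding : ∀ {n} → Graph n → Subset n → Fin n → Fin n → Set
EdgeAvoiding G F u v = u ∉ F × v ∉ F × Graph.adj G u v ≡ true

-- Only meaningful for s , t ∉ F: the empty path relates every vertex of G
-- to itself.
ConnectedAvoiding : ∀ {n} → Graph n → Subset n → Fin n → Fin n → Set
ConnectedAvoiding G F = Star (EdgeAvoiding G F)

Label : ℕ → Set
Label b = Vec Bool b

elements : ∀ {n} → Subset n → List (Fin n)
elements {n} F = filter (_∈? F) (allFin n)

-- The query algorithm receives the labels of F as an unordered collection:
-- its answer must be correct for every ordering ls of the labels L₁(v), v ∈ F.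
-- Repeated labels are kept, so this covers in particular every algorithm that
-- looks only at the set { L₁(v) ∣ v ∈ F }.
record LabelingScheme (n f b₀ b₁ : ℕ) : Set where
  field
    L₀    : Graph n → Fin n → Label b₀
    L₁    : Graph n → Fin n → Label b₁
    query : Label b₀ → Label b₀ → List (Label b₁) → Bool
    correct : ∀ (G : Graph n) (F : Subset n) (s t : Fin n) →
              ∣ F ∣ ≤ f → s ∉ F → t ∉ F →
              ∀ (ls : List (Label b₁)) → ls ↭ map (L₁ G) (elements F) →
              query (L₀ G s) (L₀ G t) ls ≡ true ⇔ ConnectedAvoiding G F s t

fromℕ : ℕ → ℚ
fromℕ k = + k / 1

{-# OPTIONS --safe #-}

-- Take the bipartite graphs between p = n - ⌈f/2⌉ left vertices and q = ⌈f/2⌉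
-- right vertices.  Deleting every right vertex except j leaves j as the only
-- possible neighbour of a left vertex i, so a query then reveals whether ij is
-- an edge.  Hence the labels L₀ of all vertices together with the labels L₁ of
-- the right vertices determine all p q bits of the graph, and
-- p q ≤ n b₀ + q b₁.  If 9 b₀ < f and 9 b₁ < n, then, as f ≤ 2 q and n ≤ 3 p,
-- 9 (n b₀ + q b₁) < n f + q n ≤ 3 n q ≤ 9 p q, a contradiction.
module Submission where

open import Data.Bool using (Bool; true; false)
open import Data.Fin using (Fin; zero; suc; _↑ˡ_; _↑ʳ_; splitAt; combine; finToFun; funToFin)
open import Data.Fin.Properties using (2↔Bool; splitAt-↑ˡ; splitAt-↑ʳ; splitAt⁻¹-↑ˡ; splitAt⁻¹-↑ʳ; combine-injective; funToFin-finToFin; finToFun-funToFin; injective⇒≤)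
open import Data.Fin.Subset using (Subset; ∣_∣; ⊥; ∁; ⁅_⁆; _∈_; _∉_)
open import Data.Fin.Subset.Properties using (∉⊥; x∈⁅x⁆; x∈p⇒x∉∁p; x∉∁p⇒x∈p; x∈⁅y⁆⇒x≡y; ∣∁p∣≡n∸∣p∣; ∣⁅x⁆∣≡1; _∈?_)
open import Data.Integer as ℤ using (+_)
import Data.Integer.Properties as ℤ
open import Data.List using (map; allFin)
open import Data.List.Properties using (map-cong-local)
import Data.List.Relation.Unary.All as All
open import Data.List.Relation.Unary.All.Properties using (all-filter)
open import Data.List.Relation.Binary.Permutation.Propositional using (↭-refl)
open import Data.Nat using (ℕ; zero; suc; _+_; _*_; _∸_; _^_; _≤_; z≤n; s≤s; z<s; s<s; >-nonZero; ⌊_/2⌋; ⌈_/2⌉)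
open import Data.Nat.Properties
open import Data.Nat.Tactic.RingSolver using (solve-∀)
open import Data.Product using (∃-syntax; _×_; _,_)
open import Data.Rational as ℚ using (ℚ; 0ℚ)
import Data.Rational.Properties as ℚ
open import Data.Rational.Unnormalised as ℚᵘ using (mkℚᵘ)
import Data.Rational.Unnormalised.Properties as ℚᵘ
open import Data.Sum as Sum using (_⊎_; inj₁; inj₂)
open import Data.Vec using (lookup; _++_)
open import Data.Vec.Properties using (lookup-++ˡ; lookup-++ʳ; []=⇒lookup; lookup⇒[]=)
open import Data.Vec.Relation.Binary.Pointwise.Extensional using (ext; Pointwise-≡⇒≡)
open import Function using (_∘_; Injective; Injection; Equivalence; Inverse)
open import Function.Properties.Inverse using (↔-sym; ↔⇒↣)
open import Relation.Binary.Construct.Closure.ReflexiveTransitive using (ε; _◅_)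
open import Relation.Binary.PropositionalEquality
open import Relation.Nullary using (yes; no; contradiction)
open import Defs

private
  variable
    m n p q : ℕ

-- Finite codes for functions, labels and bipartite adjacency.

funToFin-cong : {f g : Fin m → Fin n} → f ≗ g → funToFin f ≡ funToFin g
funToFin-cong {zero}  f≗g = refl
funToFin-cong {suc m} f≗g = cong₂ combine (f≗g zero) (funToFin-cong (f≗g ∘ suc))

funToFin-injective : {f g : Fin m → Fin n} → funToFin f ≡ funToFin g → f ≗ g
funToFin-injective {f = f} {g} eq i = begin
  f i                     ≡⟨ finToFun-funToFin f i ⟨
  finToFun (funToFin f) i ≡⟨ cong (λ k → finToFun k i) eq ⟩
  finToFun (funToFin g) i ≡⟨ finToFun-funToFin g i ⟩
  g i                     ∎
  where open ≡-Reasoning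

finToFun-injective : {k l : Fin (m ^ n)} → finToFun {m} {n} k ≗ finToFun l → k ≡ l
finToFun-injective {m} {n} {k} {l} eq = begin
  k                             ≡⟨ funToFin-finToFin {n} {m} k ⟨
  funToFin (finToFun {m} {n} k) ≡⟨ funToFin-cong eq ⟩
  funToFin (finToFun {m} {n} l) ≡⟨ funToFin-finToFin {n} {m} l ⟩
  l                             ∎
  where open ≡-Reasoning

2^-cancel-≤ : 2 ^ m ≤ 2 ^ n → m ≤ n
2^-cancel-≤ 2^m≤2^n = ≮⇒≥ λ n<m → <⇒≱ (^-monoʳ-< 2 (s<s z<s) n<m) 2^m≤2^n

encodeLabel : Label n → Fin (2 ^ n)
encodeLabel l = funToFin (Inverse.from 2↔Bool ∘ lookup l)

encodeLabel-injective : {k l : Label n} → encodeLabel k ≡ encodeLabel l → k ≡ l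
encodeLabel-injective eq =
  Pointwise-≡⇒≡ (ext λ i → Injection.injective (↔⇒↣ (↔-sym 2↔Bool)) (funToFin-injective eq i))

BipartiteAdj : ℕ → ℕ → Set
BipartiteAdj p q = Fin p → Fin q → Bool

-- Adjacency matrices are reached by decoding numbers, so the counting map below runs between two
-- `Fin` types. Matrices are then only ever compared entry by entry, which avoids function
-- extensionality.
decodeAdj : Fin ((2 ^ q) ^ p) → BipartiteAdj p q
decodeAdj k i j = Inverse.to 2↔Bool (finToFun (finToFun k i) j)

decodeAdj-injective : {k l : Fin ((2 ^ q) ^ p)} →
                      (∀ i j → decodeAdj {q} {p} k i j ≡ decodeAdj l i j) → k ≡ l
decodeAdj-injective eq =
  finToFun-injective λ i → finToFun-injective λ j → Injection.injective (↔⇒↣ 2↔Bool) (eq i j)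

-- Bipartite graphs, their fault sets, and queries that read off one edge.

bipartite : BipartiteAdj p q → Graph (p + q)
bipartite {p} {q} M = record
  { adj    = λ u v → edge (splitAt p u) (splitAt p v)
  ; sym    = λ u v → edge-sym (splitAt p u) (splitAt p v)
  ; irrefl = λ v → edge-irrefl (splitAt p v)
  }
  where
  edge : Fin p ⊎ Fin q → Fin p ⊎ Fin q → Bool
  edge (inj₁ i) (inj₂ j) = M i j
  edge (inj₂ j) (inj₁ i) = M i j
  edge (inj₁ _) (inj₁ _) = false
  edge (inj₂ _) (inj₂ _) = false

  edge-sym : ∀ x y → edge x y ≡ edge y x
  edge-sym (inj₁ _) (inj₁ _) = refl
  edge-sym (inj₁ _) (inj₂ _) = refl
  edge-sym (inj₂ _) (inj₁ _) = refl
  edge-sym (inj₂ _) (inj₂ _) = refl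

  edge-irrefl : ∀ x → edge x x ≡ false
  edge-irrefl (inj₁ _) = refl
  edge-irrefl (inj₂ _) = refl

rightExcept : ∀ p → Fin q → Subset (p + q)
rightExcept p j = ⊥ {p} ++ ∁ ⁅ j ⁆

↑ˡ∉rightExcept : (i : Fin p) (j : Fin q) → i ↑ˡ q ∉ rightExcept p j
↑ˡ∉rightExcept {p} {q} i j i∈F =
  ∉⊥ (lookup⇒[]= i ⊥ (trans (sym (lookup-++ˡ ⊥ (∁ ⁅ j ⁆) i)) ([]=⇒lookup i∈F)))

↑ʳ∉rightExcept : ∀ p (j : Fin q) → p ↑ʳ j ∉ rightExcept p j
↑ʳ∉rightExcept p j j∈F = x∈p⇒x∉∁p (x∈⁅x⁆ j)
  (lookup⇒[]= j (∁ ⁅ j ⁆) (trans (sym (lookup-++ʳ (⊥ {p}) (∁ ⁅ j ⁆) j)) ([]=⇒lookup j∈F)))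

↑ʳ∉rightExcept⇒≡ : ∀ p (k j : Fin q) → p ↑ʳ k ∉ rightExcept p j → k ≡ j
↑ʳ∉rightExcept⇒≡ p k j k∉F = x∈⁅y⁆⇒x≡y j (x∉∁p⇒x∈p λ k∈∁ → k∉F
  (lookup⇒[]= (p ↑ʳ k) (rightExcept p j) (trans (lookup-++ʳ (⊥ {p}) (∁ ⁅ j ⁆) k) ([]=⇒lookup k∈∁))))

∈rightExcept⇒right : (j : Fin q) {v : Fin (p + q)} → v ∈ rightExcept p j → ∃[ k ] p ↑ʳ k ≡ v
∈rightExcept⇒right {q} {p} j {v} v∈F with splitAt p v in eq
... | inj₁ i = contradiction (subst (_∈ rightExcept p j) (sym (splitAt⁻¹-↑ˡ eq)) v∈F)
                             (↑ˡ∉rightExcept i j)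
... | inj₂ k = k , splitAt⁻¹-↑ʳ eq

∣⊥++s∣≡∣s∣ : ∀ p (s : Subset q) → ∣ ⊥ {p} ++ s ∣ ≡ ∣ s ∣
∣⊥++s∣≡∣s∣ zero    s = refl
∣⊥++s∣≡∣s∣ (suc p) s = ∣⊥++s∣≡∣s∣ p s

∣rightExcept∣ : ∀ p (j : Fin q) → ∣ rightExcept p j ∣ ≡ q ∸ 1
∣rightExcept∣ {q} p j = begin
  ∣ rightExcept p j ∣ ≡⟨ ∣⊥++s∣≡∣s∣ p (∁ ⁅ j ⁆) ⟩
  ∣ ∁ ⁅ j ⁆ ∣         ≡⟨ ∣∁p∣≡n∸∣p∣ ⁅ j ⁆ ⟩
  q ∸ ∣ ⁅ j ⁆ ∣       ≡⟨ cong (q ∸_) (∣⁅x⁆∣≡1 j) ⟩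
  q ∸ 1               ∎
  where open ≡-Reasoning

module _ (M : BipartiteAdj p q) (i : Fin p) (j : Fin q) where

  edge⇒connected : M i j ≡ true →
                   ConnectedAvoiding (bipartite M) (rightExcept p j) (i ↑ˡ q) (p ↑ʳ j)
  edge⇒connected Mij = (↑ˡ∉rightExcept i j , ↑ʳ∉rightExcept p j , adjacent) ◅ ε
    where
    adjacent : Graph.adj (bipartite M) (i ↑ˡ q) (p ↑ʳ j) ≡ true
    adjacent rewrite splitAt-↑ˡ p i q | splitAt-↑ʳ p q j = Mij

  -- Only the first step of the path matters: it can only lead to j.
  connected⇒edge : ∀ {t} → p ↑ʳ j ≡ t →
                   ConnectedAvoiding (bipartite M) (rightExcept p j) (i ↑ˡ q) t →
                   M i j ≡ true
  connected⇒edge j≡i ε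
    with () ← trans (sym (splitAt-↑ʳ p q j)) (trans (cong (splitAt p) j≡i) (splitAt-↑ˡ p i q))
  connected⇒edge _ (_◅_ {j = v} (_ , v∉F , adjacent) _)
    rewrite splitAt-↑ˡ p i q with splitAt p v in eq
  ... | inj₂ k with refl ← splitAt⁻¹-↑ʳ {p} eq with refl ← ↑ʳ∉rightExcept⇒≡ p k j v∉F = adjacent

-- Recovering the graph from its labels, and counting.

≡true-iff⇒≡ : {a b : Bool} → (a ≡ true → b ≡ true) → (b ≡ true → a ≡ true) → a ≡ b
≡true-iff⇒≡ {false} {false} _ _ = refl
≡true-iff⇒≡ {false} {true}  _ g = g refl
≡true-iff⇒≡ {true}  {_}     f _ = sym (f refl)

module _ {f b₀ b₁ : ℕ} (S : LabelingScheme (p + q) f b₀ b₁) (q≤1+f : q ≤ suc f) where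
  open LabelingScheme S

  module _ (M N : BipartiteAdj p q)
           (L₀-≡ : ∀ v → L₀ (bipartite M) v ≡ L₀ (bipartite N) v)
           (L₁-≡ : ∀ j → L₁ (bipartite M) (p ↑ʳ j) ≡ L₁ (bipartite N) (p ↑ʳ j)) where

    private
      answer : BipartiteAdj p q → Fin p → Fin q → Bool
      answer K i j = query (L₀ (bipartite K) (i ↑ˡ q)) (L₀ (bipartite K) (p ↑ʳ j))
                           (map (L₁ (bipartite K)) (elements (rightExcept p j)))

      answer≡ : ∀ K i j → answer K i j ≡ K i j
      answer≡ K i j = ≡true-iff⇒≡
        (connected⇒edge K i j refl ∘ Equivalence.to spec)
        (Equivalence.from spec ∘ edge⇒connected K i j)
        where
        spec = correct (bipartite K) (rightExcept p j) (i ↑ˡ q) (p ↑ʳ j)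
          -- One right vertex survives, so there are `q ∸ 1` faults; `q ≤ suc f` is exactly what
          -- keeps them within the budget `f`.
          (≤-trans (≤-reflexive (∣rightExcept∣ p j)) (∸-monoˡ-≤ 1 q≤1+f))
          -- The order of `elements` depends on the fault set alone, so this single ordering serves
          -- both `M` and `N`.
          (↑ˡ∉rightExcept i j) (↑ʳ∉rightExcept p j) _ ↭-refl

      L₁-≡-on : ∀ j {v} → v ∈ rightExcept p j → L₁ (bipartite M) v ≡ L₁ (bipartite N) v
      L₁-≡-on j v∈F with k , refl ← ∈rightExcept⇒right {p = p} j v∈F = L₁-≡ k

    -- Every fault set used lies on the right, so agreement of `L₁` there is enough; this is why
    -- only `b₁ * q` bits are charged for `L₁`. Agreement of `L₀` is required on both sides because
    -- each query joins a left vertex to a right one.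
    labels-determine : ∀ i j → M i j ≡ N i j
    labels-determine i j = begin
      M i j        ≡⟨ answer≡ M i j ⟨
      answer M i j ≡⟨ cong₂ (λ x y → query x y _) (L₀-≡ _) (L₀-≡ _) ⟩
      query _ _ (map (L₁ (bipartite M)) (elements F))
        -- The list is filtered by membership in `F`, so the two label lists agree entry by entry
        -- even if `L₁` differs on left vertices.
        ≡⟨ cong (query _ _) (map-cong-local (All.map (L₁-≡-on j) (all-filter (_∈? F) (allFin _)))) ⟩
      answer N i j ≡⟨ answer≡ N i j ⟩
      N i j        ∎
      where
      open ≡-Reasoning
      F = rightExcept p j

  private
    encodeL₀ : BipartiteAdj p q → Fin ((2 ^ b₀) ^ (p + q))
    encodeL₀ M = funToFin (encodeLabel ∘ L₀ (bipartite M))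

    encodeL₁ : BipartiteAdj p q → Fin ((2 ^ b₁) ^ q)
    encodeL₁ M = funToFin (λ j → encodeLabel (L₁ (bipartite M) (p ↑ʳ j)))

    encode : Fin ((2 ^ q) ^ p) → Fin ((2 ^ b₀) ^ (p + q) * (2 ^ b₁) ^ q)
    encode k = combine (encodeL₀ (decodeAdj k)) (encodeL₁ (decodeAdj k))

    encode-injective : Injective _≡_ _≡_ encode
    encode-injective {k} {l} eq
      with eq₀ , eq₁ ← combine-injective (encodeL₀ (decodeAdj k)) (encodeL₁ (decodeAdj k)) _ _ eq
      = decodeAdj-injective (labels-determine _ _
          (λ v → encodeLabel-injective (funToFin-injective eq₀ v))
          (λ j → encodeLabel-injective (funToFin-injective eq₁ j)))

  -- Both sides are base-2 logarithms: of the number of matrices, and of the number of possible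
  -- values of `encode`, which is injective.
  information-bound : q * p ≤ b₀ * (p + q) + b₁ * q
  information-bound = 2^-cancel-≤ (begin
    2 ^ (q * p)                         ≡⟨ ^-*-assoc 2 q p ⟨
    (2 ^ q) ^ p                         ≤⟨ injective⇒≤ encode-injective ⟩
    (2 ^ b₀) ^ (p + q) * (2 ^ b₁) ^ q   ≡⟨ cong₂ _*_ (^-*-assoc 2 b₀ (p + q)) (^-*-assoc 2 b₁ q) ⟩
    2 ^ (b₀ * (p + q)) * 2 ^ (b₁ * q)   ≡⟨ ^-distribˡ-+-* 2 (b₀ * (p + q)) (b₁ * q) ⟨
    2 ^ (b₀ * (p + q) + b₁ * q)         ∎)
    where open ≤-Reasoning

-- Arithmetic leading to the constant 9.

-- The shift by 2 excludes the value 1, whose half rounds down to 0. The factor 3 is forced by the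
-- value 3, where equality holds; each further step of two adds 2 on the left and 3 on the right.
2+n≤3*⌊2+n/2⌋ : ∀ n → 2 + n ≤ 3 * ⌊ 2 + n /2⌋
2+n≤3*⌊2+n/2⌋ zero          = s≤s (s≤s z≤n)
2+n≤3*⌊2+n/2⌋ (suc zero)    = ≤-refl
2+n≤3*⌊2+n/2⌋ (suc (suc n)) = begin
  2 + (2 + n)             ≤⟨ +-mono-≤ (n≤1+n 2) (2+n≤3*⌊2+n/2⌋ n) ⟩
  3 + 3 * ⌊ 2 + n /2⌋     ≡⟨ *-suc 3 ⌊ 2 + n /2⌋ ⟨
  3 * suc ⌊ 2 + n /2⌋     ∎
  where open ≤-Reasoning

-- The worst case is `f` equal to `n`, which still leaves `⌊ n /2⌋` left vertices.
n≤3*[n∸⌈f/2⌉] : ∀ {n f} → 2 ≤ n → f ≤ n → n ≤ 3 * (n ∸ ⌈ f /2⌉)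
n≤3*[n∸⌈f/2⌉] {n} {f} (s≤s (s≤s z≤n)) f≤n = begin
  n                   ≤⟨ 2+n≤3*⌊2+n/2⌋ (n ∸ 2) ⟩
  3 * ⌊ n /2⌋         ≡⟨ cong (3 *_) (m+n∸n≡m ⌊ n /2⌋ ⌈ n /2⌉) ⟨
  3 * (⌊ n /2⌋ + ⌈ n /2⌉ ∸ ⌈ n /2⌉) ≡⟨ cong (λ k → 3 * (k ∸ ⌈ n /2⌉)) (⌊n/2⌋+⌈n/2⌉≡n n) ⟩
  3 * (n ∸ ⌈ n /2⌉)   ≤⟨ *-monoʳ-≤ 3 (∸-monoʳ-≤ n (⌈n/2⌉-mono f≤n)) ⟩
  3 * (n ∸ ⌈ f /2⌉)   ∎
  where open ≤-Reasoning

n≤2*⌈n/2⌉ : ∀ n → n ≤ 2 * ⌈ n /2⌉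
n≤2*⌈n/2⌉ n = begin
  n                       ≡⟨ ⌊n/2⌋+⌈n/2⌉≡n n ⟨
  ⌊ n /2⌋ + ⌈ n /2⌉       ≤⟨ +-monoˡ-≤ ⌈ n /2⌉ (⌊n/2⌋≤⌈n/2⌉ n) ⟩
  ⌈ n /2⌉ + ⌈ n /2⌉       ≡⟨ cong (_+_ ⌈ n /2⌉) (+-identityʳ ⌈ n /2⌉) ⟨
  2 * ⌈ n /2⌉             ∎
  where open ≤-Reasoning

information-bound⇒f≤9b₀⊎n≤9b₁ : ∀ {n f} b₀ b₁ {p q} → 2 ≤ n → n ≤ 3 * p → f ≤ 2 * q →
                     q * p ≤ b₀ * n + b₁ * q → f ≤ 9 * b₀ ⊎ n ≤ 9 * b₁
information-bound⇒f≤9b₀⊎n≤9b₁ {n} {f} b₀ b₁ {p} {q} 2≤n n≤3p f≤2q bound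
  with f ≤? 9 * b₀ | n ≤? 9 * b₁
... | yes f≤9b₀ | _         = inj₁ f≤9b₀
... | no _      | yes n≤9b₁ = inj₂ n≤9b₁
... | no f≰9b₀  | no n≰9b₁  = contradiction (begin-strict
    9 * (q * p)                   ≤⟨ *-monoʳ-≤ 9 bound ⟩
    9 * (b₀ * n + b₁ * q)         ≡⟨ expand b₀ b₁ n q ⟩
    -- Strictness comes from the first summand, where `n` is positive; a weak inequality suffices
    -- for the second.
    9 * b₀ * n + 9 * b₁ * q       <⟨ +-mono-<-≤ (*-monoˡ-< n ⦃ >-nonZero (<⇒≤ 2≤n) ⦄ (≰⇒> f≰9b₀))
                                                (*-monoˡ-≤ q (≰⇒≥ n≰9b₁)) ⟩
    f * n + n * q                 ≤⟨ +-monoˡ-≤ (n * q) (*-monoˡ-≤ n f≤2q) ⟩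
    2 * q * n + n * q             ≡⟨ collect n q ⟩
    3 * (q * n)                   ≤⟨ *-monoʳ-≤ 3 (*-monoʳ-≤ q n≤3p) ⟩
    3 * (q * (3 * p))             ≡⟨ rearrange p q ⟩
    9 * (q * p)                   ∎) (<-irrefl refl)
  where
  open ≤-Reasoning
  expand : ∀ b₀ b₁ n q → 9 * (b₀ * n + b₁ * q) ≡ 9 * b₀ * n + 9 * b₁ * q
  expand = solve-∀
  collect : ∀ n q → 2 * q * n + n * q ≡ 3 * (q * n)
  collect = solve-∀
  rearrange : ∀ p q → 3 * (q * (3 * p)) ≡ 9 * (q * p)
  rearrange = solve-∀

-- Rational form of the bound and choice of the two sides.

1/9 : ℚ
1/9 = + 1 ℚ./ 9

m≤9*n⇒1/9*m≤n : ∀ m n → m ≤ 9 * n → 1/9 ℚ.* fromℕ m ℚ.≤ fromℕ n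
m≤9*n⇒1/9*m≤n m n m≤9n = ℚ.toℚᵘ-cancel-≤ (begin
  ℚ.toℚᵘ (1/9 ℚ.* fromℕ m)          ≃⟨ ℚ.toℚᵘ-homo-* 1/9 (fromℕ m) ⟩
  ℚ.toℚᵘ 1/9 ℚᵘ.* ℚ.toℚᵘ (fromℕ m)  ≃⟨ ℚᵘ.*-congˡ {ℚ.toℚᵘ 1/9} (ℚ.toℚᵘ-fromℚᵘ (mkℚᵘ (+ m) 0)) ⟩
  -- `mkℚᵘ` stores the denominator minus one, so 8 and 0 stand for denominators 9 and 1.
  -- Unnormalised fractions reduce the claim to cross-multiplication in the integers.
  mkℚᵘ (+ 1) 8 ℚᵘ.* mkℚᵘ (+ m) 0    ≤⟨ ℚᵘ.*≤* cross ⟩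
  mkℚᵘ (+ n) 0                      ≃⟨ ℚ.toℚᵘ-fromℚᵘ (mkℚᵘ (+ n) 0) ⟨
  ℚ.toℚᵘ (fromℕ n)                  ∎)
  where
  open ℚᵘ.≤-Reasoning
  cross : (+ 1 ℤ.* + m) ℤ.* + 1 ℤ.≤ + n ℤ.* + 9
  cross = subst₂ ℤ._≤_
    (sym (trans (ℤ.*-identityʳ _) (ℤ.*-identityˡ (+ m))))
    (trans (cong +_ (*-comm 9 n)) (ℤ.pos-* n 9))
    (ℤ.+≤+ m≤9n)

-- Halving `f` balances two demands: the right side must have order `f` vertices, yet taking all `f`
-- of them would leave no left vertex when `f` equals `n`.
scheme-bound : ∀ {n f b₀ b₁} → 2 ≤ n → f ≤ n → LabelingScheme n f b₀ b₁ →
               f ≤ 9 * b₀ ⊎ n ≤ 9 * b₁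
scheme-bound {n} {f} {b₀} {b₁} 2≤n f≤n S =
  information-bound⇒f≤9b₀⊎n≤9b₁ b₀ b₁ {left} {right} 2≤n (n≤3*[n∸⌈f/2⌉] 2≤n f≤n) (n≤2*⌈n/2⌉ f)
    (subst (λ k → right * left ≤ b₀ * k + b₁ * right) left+right≡n
      (information-bound {left} {right} (subst (λ k → LabelingScheme k f b₀ b₁) (sym left+right≡n) S)
        (m≤n⇒m≤1+n (⌈n/2⌉≤n f))))
  where
  right = ⌈ f /2⌉
  left  = n ∸ right
  left+right≡n : left + right ≡ n
  left+right≡n = m∸n+n≡m (≤-trans (⌈n/2⌉≤n f) f≤n)

theorem9p1 : ∃[ c ] (0ℚ ℚ.< c × (∀ (n f b₀ b₁ : ℕ) → 2 ≤ n → f ≤ n → LabelingScheme n f b₀ b₁ →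
    (c ℚ.* fromℕ f ℚ.≤ fromℕ b₀) ⊎ (c ℚ.* fromℕ n ℚ.≤ fromℕ b₁)))
theorem9p1 = 1/9 , ℚ.positive⁻¹ 1/9 , λ n f b₀ b₁ 2≤n f≤n S →
  Sum.map (m≤9*n⇒1/9*m≤n f b₀) (m≤9*n⇒1/9*m≤n n b₁) (scheme-bound 2≤n f≤n S)
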